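{- Let $a\ge2$ be an integer. Then $$D_{2^a+1}\equiv 3+2^{a+2}\pmod{4^{a+1}}\qquad\text{and}\qquad D_{2^a-1}\equiv -1\pmod{4^{a+1}}.$$
   Context: $D_n=\sum_{k=0}^{n}\binom{n}{k}\binom{n+k}{k}$ are the central Delannoy numbers. -}

module Defs where

open import Data.Nat.Base using (ℕ; suc; _+_; _*_)
open import Data.Nat.Combinatorics using (_C_)
open import Data.Nat.ListAction using (sum)
open import Data.List.Base using (map; upTo)
open import Data.Integer.Base using (ℤ; _-_)
open import Data.Integer.Divisibility.Signed using (_∣_)

-- Central Delannoy numbers; upTo (suc n) lists 0, 1, …, n.
D : ℕ → ℕ
D n = sum (map (λ k → (n C k) * ((n + k) C k)) (upTo (suc n)))

infix 4 _≡_[mod_]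

_≡_[mod_] : ℤ → ℤ → ℤ → Set
x ≡ y [mod m ] = m ∣ (x - y)

{-# OPTIONS --safe #-}
module Submission where

-- Write D_{n+1} + D_n = 4S and D_{n+1} − D_n = 2T with S = ∑ C(n,k) C(n+1+k,k) and
-- T = ∑ C(n+1,k+1) C(n+1+k,k), and let M = n + 1 = 2N be divisible by 8.  Pairing consecutive terms
-- gives 2S ≡ 0 (mod 4M²).  Comparing the terms of T for M with those for N splits T modulo 4M² into
-- an alternating sum for N, equal to 1, and M ∑ (−1)ʲ C(N−1,j) C(N+j,j) / (2j+1), which vanishes for
-- even N.  Hence T ≡ 1, D_{M−1} = 2S − T ≡ −1, D_M = 2S + T ≡ 1, and the recurrence for the
-- Delannoy numbers yields D_{M+1} ≡ 3 + 4M.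

open import Defs
open import Data.Nat.Base using (ℕ; zero; suc; s≤s)
open import Data.Product.Base using (∃; _,_; proj₁; proj₂)
open import Data.Integer.Base using (ℤ; +_; -1ℤ)
open import Data.Integer.Divisibility.Signed using (divides)
open import Relation.Binary.PropositionalEquality

-- The comparison of M with N rests on a product: up to sign, the terms of S are ∏ (1 - M²/i²) over
-- i ≤ k. The factors with i = 2l are the factors 1 - N²/l² belonging to N. The odd i are units
-- modulo powers of two, so their factors can be expanded in M² and leave only a sign and a linear
-- correction. The terms of T are M/(k + 1) times those of S. For odd k this ratio is again the one
-- for N; for even k the odd denominator survives and becomes the weight 1/(2j + 1). Such weights
-- make sense only as residues, so the termwise identities are kept over the integers with
-- denominators cleared, and odd factors are cancelled in the congruences. Divisibility of M by 8
-- enters three times: 4 divides N, which absorbs the linear correction; 4 divides M, which makes M³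
-- a multiple of 4M²; and N is even, which makes the sum S for N even. The case a = 2, where M = 4,
-- is evaluated directly.

private module DelannoyCongruences where

  import Data.Nat.Base as ℕ
  import Data.Nat.Properties as ℕ
  open import Data.Nat.Combinatorics using (_C_; nCk≡nC[n∸k]; nCk+nC[k+1]≡[n+1]C[k+1]; k>n⇒nCk≡0; nC1≡n)
  open import Data.Nat.ListAction using (sum)
  open import Data.Nat.ListAction.Properties using (sum-++)
  open import Data.List.Base using (map; upTo; _∷ʳ_)
  open import Data.List.Properties using (map-++; upTo-∷ʳ)
  open import Data.Integer.Base hiding (suc)
  open import Data.Integer.Properties
  open import Data.Integer.Tactic.RingSolver using (solve-∀)
  open import Function.Base using (_∘_)

  -- Termwise identities

  infix 9 _choose_

  _choose_ : ℕ → ℕ → ℤ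
  n choose k = + (n C k)

  -- (−1)ᵏ h n k = ∏ (1 − (n+1)²/i²) over 1 ≤ i ≤ k.
  f h g : ℕ → ℕ → ℤ
  f n k = n choose k * (n ℕ.+ k) choose k
  h n k = n choose k * (suc n ℕ.+ k) choose k
  g n k = suc n choose suc k * (suc n ℕ.+ k) choose k

  infixr 6.5 _•_
  infixl 6 _⊞_

  _•_ : ∀ c {l r : ℤ} → l ≡ r → c * l ≡ c * r
  c • eq = cong (c *_) eq

  _⊞_ : {l r l′ r′ : ℤ} → l ≡ r → l′ ≡ r′ → l + l′ ≡ r + r′
  _⊞_ = cong₂ _+_

  -- Proof by linear combination: known equations, scaled with `_•_` and added with `_⊞_`, form
  -- `l ≡ r`. What remains is a polynomial identity in which binomials and sums are atoms, left to
  -- the ring solver.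
  linear : ∀ {l r x y} → l ≡ r → x - y ≡ l - r → x ≡ y
  linear {l} {x = x} {y} refl eq = i-j≡0⇒i≡j x y (trans eq (+-inverseʳ l))

  pascal : ∀ n k → suc n choose suc k ≡ n choose k + n choose suc k
  pascal n k = cong +_ (sym (nCk+nC[k+1]≡[n+1]C[k+1] n k))

  absorption : ∀ n k → + suc k * suc n choose suc k ≡ + suc n * n choose k
  absorption zero zero = refl
  absorption zero (suc k) = *-zeroʳ (+ suc (suc k))
  absorption (suc n) zero = trans (cong (λ j → 1ℤ * + j) (nC1≡n (suc (suc n)))) (*-comm 1ℤ (+ suc (suc n)))
  absorption (suc n) (suc k) = linear
    (+ suc (suc k) • pascal (suc n) (suc k) ⊞ absorption n (suc k) ⊞ absorption n k
      ⊞ - + suc n • pascal n k)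
    (identity (+ k) (+ n) (suc (suc n) choose suc (suc k)) (suc n choose suc k) (suc n choose suc (suc k))
      (n choose suc k) (n choose k))
    where
    identity : ∀ k n x y z u v →
      (+ 2 + k) * x - (+ 2 + n) * y ≡
      (+ 2 + k) * x + (+ 2 + k) * z + (1ℤ + k) * y + - (1ℤ + n) * y
        - ((+ 2 + k) * (y + z) + (1ℤ + n) * u + (1ℤ + n) * v + - (1ℤ + n) * (v + u))
    identity = solve-∀

  absorption-upper : ∀ n k → + suc n * (suc n ℕ.+ k) choose k ≡ + suc (n ℕ.+ k) * (n ℕ.+ k) choose k
  absorption-upper n k = begin
    + suc n * (suc n ℕ.+ k) choose k ≡⟨ cong (λ j → + suc n * + j) (symmetric (suc n)) ⟩
    + suc n * (suc n ℕ.+ k) choose suc n ≡⟨ absorption (n ℕ.+ k) n ⟩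
    + suc (n ℕ.+ k) * (n ℕ.+ k) choose n ≡⟨ cong (λ j → + suc (n ℕ.+ k) * + j) (symmetric n) ⟨
    + suc (n ℕ.+ k) * (n ℕ.+ k) choose k ∎
    where
    open ≡-Reasoning
    symmetric : ∀ m → (m ℕ.+ k) C k ≡ (m ℕ.+ k) C m
    symmetric m = trans (nCk≡nC[n∸k] (ℕ.m≤n+m k m)) (cong ((m ℕ.+ k) C_) (ℕ.m+n∸n≡m m k))

  [k+1]g≡[n+1]h : ∀ n k → + suc k * g n k ≡ + suc n * h n k
  [k+1]g≡[n+1]h n k = linear
    ((suc n ℕ.+ k) choose k • absorption n k) (identity (+ k) (+ n) (suc n choose suc k) (n choose k) ((suc n ℕ.+ k) choose k))
    where
    identity : ∀ k n x y z → (1ℤ + k) * (x * z) - (1ℤ + n) * (y * z) ≡ z * ((1ℤ + k) * x) - z * ((1ℤ + n) * y)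
    identity = solve-∀

  [n+1]h≡[n+1+k]f : ∀ n k → + suc n * h n k ≡ + suc (n ℕ.+ k) * f n k
  [n+1]h≡[n+1+k]f n k = linear
    (n choose k • absorption-upper n k) (identity (+ suc n) (+ suc (n ℕ.+ k)) (n choose k) ((suc n ℕ.+ k) choose k) ((n ℕ.+ k) choose k))
    where
    identity : ∀ n m x y z → n * (x * y) - m * (x * z) ≡ x * (n * y) - x * (m * z)
    identity = solve-∀

  [n+1]h+kf≡[n+1]f : ∀ n k → + suc n * h n k + + k * f (suc n) k ≡ + suc n * f (suc n) k
  [n+1]h+kf≡[n+1]f n zero = +-identityʳ (+ suc n * h n 0)
  [n+1]h+kf≡[n+1]f n (suc k) = linear
    (z • (absorption n k ⊞ - + suc n • pascal n k)) (identity (+ k) (+ n) (suc n choose suc k) (n choose suc k) (n choose k) z)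
    where
    z = suc (n ℕ.+ suc k) choose suc k
    identity : ∀ k n x y u z →
      (1ℤ + n) * (y * z) + (1ℤ + k) * (x * z) - (1ℤ + n) * (x * z) ≡
      z * ((1ℤ + k) * x + - (1ℤ + n) * x) - z * ((1ℤ + n) * u + - (1ℤ + n) * (u + y))
    identity = solve-∀

  f-next : ∀ n k → f n (suc k) ≡ n choose suc k * (suc n ℕ.+ k) choose suc k
  f-next n k = cong (λ j → n choose suc k * j choose suc k) (ℕ.+-suc n k)

  h-next : ∀ n k → h n (suc k) ≡ n choose suc k * (suc (suc n) ℕ.+ k) choose suc k
  h-next n k = cong (λ j → n choose suc k * suc j choose suc k) (ℕ.+-suc n k)

  -- Serves `F≡2S-G`: summed over k, `h` is counted twice, once with shifted index.
  f-pred : ∀ n k → f n (suc k) ≡ h n (suc k) + h n k - g n k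
  f-pred n k = linear
    (f-next n k ⊞ -1ℤ • h-next n k ⊞ - n choose suc k • pascal (suc n ℕ.+ k) k
      ⊞ (suc n ℕ.+ k) choose k • pascal n k)
    (identity (n choose k) (n choose suc k) (suc n choose suc k) ((suc n ℕ.+ k) choose k)
      ((suc n ℕ.+ k) choose suc k) ((suc (suc n) ℕ.+ k) choose suc k) (f n (suc k)) (h n (suc k)))
    where
    identity : ∀ a a′ b c d e x y →
      x - (y + a * c - b * c) ≡
      x + -1ℤ * y + - a′ * e + c * b - (a′ * d + -1ℤ * (a′ * e) + - a′ * (c + d) + c * (a + a′))
    identity = solve-∀

  -- A second factorisation of `g`: multiplied by k + 1, both sides become (n + 1) `h n k`.
  diagonal : ∀ n k → n choose k * (suc n ℕ.+ k) choose suc k ≡ g n k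
  diagonal n k = *-cancelˡ-≡ (+ suc k) _ _ (linear
    (n choose k • absorption (n ℕ.+ k) k ⊞ - (n choose k) • absorption-upper n k
      ⊞ - ((suc n ℕ.+ k) choose k) • absorption n k)
    (identity (+ k) (+ n) (+ suc (n ℕ.+ k)) (n choose k) (suc n choose suc k) ((suc n ℕ.+ k) choose k)
      ((suc n ℕ.+ k) choose suc k) ((n ℕ.+ k) choose k)))
    where
    identity : ∀ k n s a b c d e → (1ℤ + k) * (a * d) - (1ℤ + k) * (b * c) ≡
      a * ((1ℤ + k) * d) + - a * ((1ℤ + n) * c) + - c * ((1ℤ + k) * b)
        - (a * (s * e) + - a * (s * e) + - c * ((1ℤ + n) * a))
    identity = solve-∀

  f-suc : ∀ n k → f (suc n) (suc k) ≡ f n (suc k) + + 2 * g n k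
  f-suc n k = linear
    (f-next (suc n) k ⊞ -1ℤ • f-next n k ⊞ suc n choose suc k • pascal (suc n ℕ.+ k) k
      ⊞ (suc n ℕ.+ k) choose suc k • pascal n k ⊞ diagonal n k)
    (identity (n choose k) (n choose suc k) (suc n choose suc k) ((suc n ℕ.+ k) choose k)
      ((suc n ℕ.+ k) choose suc k) ((suc (suc n) ℕ.+ k) choose suc k) (f (suc n) (suc k)) (f n (suc k)))
    where
    identity : ∀ a a′ b c d e x y →
      x - (y + + 2 * (b * c)) ≡
      x + -1ℤ * y + b * e + d * b + a * d
        - (b * e + -1ℤ * (a′ * d) + b * (c + d) + d * (a + a′) + b * c)
    identity = solve-∀

  -- One factor of the product formula with its denominator cleared. The square (n + 1)² on the
  -- right is the source of the divisibility of paired terms by M².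
  h-recurrence : ∀ n k → + suc k * + suc k * (h n (suc k) + h n k) ≡ + suc n * + suc n * h n k
  h-recurrence n k = linear
    (K * K • (h-next n k ⊞ a′ • pascal (suc n ℕ.+ k) k ⊞ - (c + d) • pascal n k ⊞ -1ℤ • diagonal n k)
      ⊞ K * d • absorption n k ⊞ N * a • absorption (n ℕ.+ k) k ⊞ - (N * a) • absorption-upper n k)
    (identity K N a a′ (suc n choose suc k) c d ((suc (suc n) ℕ.+ k) choose suc k)
      (+ suc (n ℕ.+ k)) ((n ℕ.+ k) choose k) (h n (suc k)))
    where
    K = + suc k
    N = + suc n
    a = n choose k
    a′ = n choose suc k
    c = (suc n ℕ.+ k) choose k
    d = (suc n ℕ.+ k) choose suc k
    identity : ∀ k n a a′ b c d e s t x → k * k * (x + a * c) - n * n * (a * c) ≡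
      k * k * (x + a′ * e + - (c + d) * b + -1ℤ * (a * d)) + k * d * (k * b)
        + n * a * (k * d) + - (n * a) * (n * c)
      - (k * k * (a′ * e + a′ * (c + d) + - (c + d) * (a + a′) + -1ℤ * (b * c)) + k * d * (n * a)
        + n * a * (s * t) + - (n * a) * (s * t))
    identity = solve-∀

  -- Both `h` terms are multiples of `f (suc n) k`, with factors n + 2 + k and n + 1 - k; these
  -- differ by 2k + 1.
  h-suc : ∀ n k → + suc (suc n) * h (suc n) k ≡ + suc n * h n k + (1ℤ + + 2 * + k) * f (suc n) k
  h-suc n k = linear ([n+1]h≡[n+1+k]f (suc n) k ⊞ -1ℤ • [n+1]h+kf≡[n+1]f n k)
    (identity (+ k) (+ n) (h (suc n) k) (h n k) (f (suc n) k))
    where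
    identity : ∀ k n x y z → (+ 2 + n) * x - ((1ℤ + n) * y + (1ℤ + + 2 * k) * z) ≡
      (+ 2 + n) * x + -1ℤ * ((1ℤ + n) * y + k * z) - ((+ 2 + (n + k)) * z + -1ℤ * ((1ℤ + n) * z))
    identity = solve-∀

  -- After multiplication by k + 1, the coefficient of `f (suc n) k` is (n + 2)(n + 2 + k) - (n +
  -- 1)(n + 1 - k) = (2n + 3)(k + 1), so k + 1 cancels.
  g-suc : ∀ n k → + suc (suc n) * g (suc n) k ≡ + suc n * g n k + (+ 3 + + 2 * + n) * f (suc n) k
  g-suc n k = *-cancelˡ-≡ (+ suc k) _ _ (linear
    ((+ 2 + + n) • ([k+1]g≡[n+1]h (suc n) k ⊞ [n+1]h≡[n+1+k]f (suc n) k)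
      ⊞ - (1ℤ + + n) • ([k+1]g≡[n+1]h n k ⊞ [n+1]h+kf≡[n+1]f n k))
    (identity (+ k) (+ n) (g (suc n) k) (g n k) (f (suc n) k) (h n k) (h (suc n) k)))
    where
    identity : ∀ k n x y z u v →
      (1ℤ + k) * ((+ 2 + n) * x) - (1ℤ + k) * ((1ℤ + n) * y + (+ 3 + + 2 * n) * z) ≡
      (+ 2 + n) * ((1ℤ + k) * x + (+ 2 + n) * v) + - (1ℤ + n) * ((1ℤ + k) * y + ((1ℤ + n) * u + k * z))
      - ((+ 2 + n) * ((+ 2 + n) * v + (+ 2 + (n + k)) * z) + - (1ℤ + n) * ((1ℤ + n) * u + (1ℤ + n) * z))
    identity = solve-∀

  -- Sums and their recurrences

  ∑ : ℕ → (ℕ → ℤ) → ℤ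
  ∑ zero u = 0ℤ
  ∑ (suc n) u = ∑ n u + u n

  ∑-cong : ∀ n {u v} → (∀ k → u k ≡ v k) → ∑ n u ≡ ∑ n v
  ∑-cong zero u≡v = refl
  ∑-cong (suc n) u≡v = cong₂ _+_ (∑-cong n u≡v) (u≡v n)

  ∑-+ : ∀ n u v → ∑ n (λ k → u k + v k) ≡ ∑ n u + ∑ n v
  ∑-+ zero u v = refl
  ∑-+ (suc n) u v = linear (∑-+ n u v) (identity (∑ n (λ k → u k + v k)) (∑ n u) (∑ n v) (u n) (v n))
    where
    identity : ∀ s t t′ x y → s + (x + y) - (t + x + (t′ + y)) ≡ s - (t + t′)
    identity = solve-∀

  ∑-*ˡ : ∀ n c u → ∑ n (λ k → c * u k) ≡ c * ∑ n u
  ∑-*ˡ zero c u = sym (*-zeroʳ c)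
  ∑-*ˡ (suc n) c u = trans (cong (_+ c * u n) (∑-*ˡ n c u)) (sym (*-distribˡ-+ c (∑ n u) (u n)))

  ∑-head : ∀ n u → ∑ (suc n) u ≡ u 0 + ∑ n (u ∘ suc)
  ∑-head zero u = +-comm 0ℤ (u 0)
  ∑-head (suc n) u = trans (cong (_+ u (suc n)) (∑-head n u)) (+-assoc (u 0) (∑ n (u ∘ suc)) (u (suc n)))

  ∑-shift : ∀ n u → u (suc n) ≡ 0ℤ → u 0 + ∑ (suc n) (u ∘ suc) ≡ ∑ (suc n) u
  ∑-shift n u last = trans (sym (∑-head (suc n) u)) (trans (cong (λ x → ∑ (suc n) u + x) last) (+-identityʳ (∑ (suc n) u)))

  ∑-pairs : ∀ n u → ∑ (n ℕ.* 2) u ≡ ∑ n (λ j → u (j ℕ.* 2) + u (suc (j ℕ.* 2)))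
  ∑-pairs zero u = refl
  ∑-pairs (suc n) u = trans
    (+-assoc (∑ (n ℕ.* 2) u) (u (n ℕ.* 2)) (u (suc (n ℕ.* 2))))
    (cong (_+ (u (n ℕ.* 2) + u (suc (n ℕ.* 2)))) (∑-pairs n u))

  S : ℕ → ℤ
  S n = ∑ (suc n) (h n)

  -- `F x n` is the Legendre polynomial P_n at 1 + 2x, and 2x `G x n` is the difference P_{n+1} -
  -- P_n there. The variable lets the same recurrences serve x = 1 (Delannoy numbers) and x = -1
  -- (alternating sums).
  F G : ℤ → ℕ → ℤ
  F x n = ∑ (suc n) (λ k → f n k * x ^ k)
  G x n = ∑ (suc n) (λ k → g n k * x ^ k)

  choose-beyond : ∀ n → n choose suc n ≡ 0ℤ
  choose-beyond n = cong +_ (k>n⇒nCk≡0 (ℕ.n<1+n n))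

  vanish : ∀ {x} y z → x ≡ 0ℤ → x * y * z ≡ 0ℤ
  vanish y z refl = refl

  F-suc : ∀ x n → F x (suc n) ≡ F x n + + 2 * x * G x n
  F-suc x n = linear
    (∑-head (suc n) (λ k → f (suc n) k * x ^ k)
      ⊞ ∑-cong (suc n) term
      ⊞ ∑-+ (suc n) (λ k → f n (suc k) * x ^ suc k) (λ k → + 2 * x * (g n k * x ^ k))
      ⊞ ∑-*ˡ (suc n) (+ 2 * x) (λ k → g n k * x ^ k)
      ⊞ ∑-shift n (λ k → f n k * x ^ k) (vanish ((n ℕ.+ suc n) choose suc n) (x ^ suc n) (choose-beyond n)))
    (identity (F x (suc n)) (F x n) (G x n) (+ 2 * x)
      (∑ (suc n) (λ k → f (suc n) (suc k) * x ^ suc k))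
      (∑ (suc n) (λ k → f n (suc k) * x ^ suc k + + 2 * x * (g n k * x ^ k)))
      (∑ (suc n) (λ k → f n (suc k) * x ^ suc k))
      (∑ (suc n) (λ k → + 2 * x * (g n k * x ^ k))))
    where
    expand : ∀ a b x y → (a + + 2 * b) * (x * y) ≡ a * (x * y) + + 2 * x * (b * y)
    expand = solve-∀
    term : ∀ k → f (suc n) (suc k) * x ^ suc k ≡ f n (suc k) * x ^ suc k + + 2 * x * (g n k * x ^ k)
    term k = trans (cong (_* x ^ suc k) (f-suc n k)) (expand (f n (suc k)) (g n k) x (x ^ k))
    identity : ∀ F′ F G c a b d e → F′ - (F + c * G) ≡
      F′ + a + b + e + (1ℤ + d) - (1ℤ + a + b + (d + e) + c * G + F)
    identity = solve-∀

  -- Together with `F-suc` this is Bonnet's three-term recurrence, split into two first-order steps.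
  G-suc : ∀ x n → + suc (suc n) * G x (suc n) ≡ + suc n * G x n + (+ 3 + + 2 * + n) * F x (suc n)
  G-suc x n = linear
    (-1ℤ • ∑-*ˡ (suc (suc n)) N′ (λ k → g (suc n) k * x ^ k)
      ⊞ ∑-cong (suc (suc n)) term
      ⊞ ∑-+ (suc (suc n)) (λ k → N * (g n k * x ^ k)) (λ k → c * (f (suc n) k * x ^ k))
      ⊞ ∑-*ˡ (suc (suc n)) N (λ k → g n k * x ^ k)
      ⊞ ∑-*ˡ (suc (suc n)) c (λ k → f (suc n) k * x ^ k)
      ⊞ N • vanish ((suc n ℕ.+ suc n) choose suc n) (x ^ suc n) (choose-beyond (suc n)))
    (identity N′ N c (G x (suc n)) (G x n) (F x (suc n))
      (∑ (suc (suc n)) (λ k → N′ * (g (suc n) k * x ^ k)))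
      (∑ (suc (suc n)) (λ k → N * (g n k * x ^ k) + c * (f (suc n) k * x ^ k)))
      (∑ (suc (suc n)) (λ k → N * (g n k * x ^ k)))
      (∑ (suc (suc n)) (λ k → c * (f (suc n) k * x ^ k)))
      (g n (suc n) * x ^ suc n))
    where
    N = + suc n
    N′ = + suc (suc n)
    c = + 3 + + 2 * + n
    associate : ∀ N′ a y → N′ * (a * y) ≡ N′ * a * y
    associate = solve-∀
    expand : ∀ N b c d y → (N * b + c * d) * y ≡ N * (b * y) + c * (d * y)
    expand = solve-∀
    term : ∀ k → N′ * (g (suc n) k * x ^ k) ≡ N * (g n k * x ^ k) + c * (f (suc n) k * x ^ k)
    term k = trans (associate N′ (g (suc n) k) (x ^ k))
      (trans (cong (_* x ^ k) (g-suc n k)) (expand N (g n k) c (f (suc n) k) (x ^ k)))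
    identity : ∀ N′ N c G′ G F a b d e l → N′ * G′ - (N * G + c * F) ≡
      -1ℤ * a + a + b + d + e + N * l - (-1ℤ * (N′ * G′) + b + (d + e) + N * (G + l) + c * F + N * 0ℤ)
    identity = solve-∀

  -- This is P_n(-1) = (-1)ⁿ. The two closed forms are proved by mutual induction, since each
  -- recurrence involves both sums.
  F-alternating : ∀ n → F -1ℤ n ≡ -1ℤ ^ n
  G-alternating : ∀ n → G -1ℤ n ≡ -1ℤ ^ n
  F-alternating zero = refl
  F-alternating (suc n) = linear
    (F-suc -1ℤ n ⊞ F-alternating n ⊞ - (+ 2) • G-alternating n)
    (identity (F -1ℤ (suc n)) (F -1ℤ n) (G -1ℤ n) (-1ℤ ^ n))
    where
    identity : ∀ F′ F G e → F′ - -1ℤ * e ≡ F′ + F + - (+ 2) * G - (F + + 2 * -1ℤ * G + e + - (+ 2) * e)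
    identity = solve-∀
  G-alternating zero = refl
  G-alternating (suc n) = *-cancelˡ-≡ (+ suc (suc n)) (G -1ℤ (suc n)) (-1ℤ ^ suc n) (linear
    (G-suc -1ℤ n ⊞ + suc n • G-alternating n ⊞ (+ 3 + + 2 * + n) • F-alternating (suc n))
    (identity (+ n) (G -1ℤ (suc n)) (G -1ℤ n) (F -1ℤ (suc n)) (-1ℤ ^ n)))
    where
    identity : ∀ n G′ G F′ e → (+ 2 + n) * G′ - (+ 2 + n) * (-1ℤ * e) ≡
      (+ 2 + n) * G′ + (1ℤ + n) * G + (+ 3 + + 2 * n) * F′
        - ((1ℤ + n) * G + (+ 3 + + 2 * n) * F′ + (1ℤ + n) * e + (+ 3 + + 2 * n) * (-1ℤ * e))
    identity = solve-∀

  *-1^ : ∀ x k → x * 1ℤ ^ k ≡ x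
  *-1^ x k = trans (cong (x *_) (^-zeroˡ k)) (*-identityʳ x)

  F≡2S-G : ∀ n → F 1ℤ n ≡ + 2 * S n - G 1ℤ n
  F≡2S-G n = linear
    (∑-cong (suc n) (λ k → *-1^ (f n k) k)
      ⊞ ∑-cong (suc n) (λ k → *-1^ (g n k) k)
      ⊞ -1ℤ • ∑-shift n (f n) (vanish₁ ((n ℕ.+ suc n) choose suc n) (choose-beyond n))
      ⊞ ∑-cong (suc n) (f-pred n)
      ⊞ ∑-+ (suc n) (λ k → h n (suc k) + h n k) (λ k → - g n k)
      ⊞ ∑-+ (suc n) (h n ∘ suc) (h n)
      ⊞ ∑-shift n (h n) (vanish₁ ((suc n ℕ.+ suc n) choose suc n) (choose-beyond n))
      ⊞ ∑-cong (suc n) (λ k → sym (-1*i≡-i (g n k)))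
      ⊞ ∑-*ˡ (suc n) -1ℤ (g n))
    (identity (F 1ℤ n) (G 1ℤ n) (S n) (∑ (suc n) (f n)) (∑ (suc n) (g n)) (∑ (suc n) (f n ∘ suc))
      (∑ (suc n) (λ k → h n (suc k) + h n k - g n k)) (∑ (suc n) (λ k → h n (suc k) + h n k))
      (∑ (suc n) (λ k → - g n k)) (∑ (suc n) (h n ∘ suc)) (∑ (suc n) (λ k → -1ℤ * g n k)))
    where
    vanish₁ : ∀ {x} y → x ≡ 0ℤ → x * y ≡ 0ℤ
    vanish₁ y refl = refl
    identity : ∀ F G S f g f′ a b c h′ d → F - (+ 2 * S - G) ≡
      F + G + -1ℤ * (1ℤ + f′) + f′ + a + b + (1ℤ + h′) + c + d
        - (f + g + -1ℤ * f + a + (b + c) + (h′ + S) + S + d + -1ℤ * g)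
    identity = solve-∀

  sum-upTo : ∀ u n → + sum (map u (upTo n)) ≡ ∑ n (+_ ∘ u)
  sum-upTo u zero = refl
  sum-upTo u (suc n) = begin
    + sum (map u (upTo (suc n)))                      ≡⟨ cong (λ ks → + sum (map u ks)) (upTo-∷ʳ n) ⟨
    + sum (map u (upTo n ∷ʳ n))                       ≡⟨ cong (+_ ∘ sum) (map-++ u (upTo n) _) ⟩
    + sum (map u (upTo n) ∷ʳ u n)                     ≡⟨ cong +_ (sum-++ (map u (upTo n)) _) ⟩
    + sum (map u (upTo n)) + + (u n ℕ.+ 0)            ≡⟨ cong₂ (λ x y → x + + y) (sum-upTo u n) (ℕ.+-identityʳ (u n)) ⟩
    ∑ (suc n) (+_ ∘ u)                                ∎
    where open ≡-Reasoning

  D≡F : ∀ n → + D n ≡ F 1ℤ n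
  D≡F n = trans (sum-upTo (λ k → (n C k) ℕ.* ((n ℕ.+ k) C k)) (suc n))
    (∑-cong (suc n) (λ k → trans (pos-* (n C k) ((n ℕ.+ k) C k)) (sym (*-1^ (f n k) k))))

  -- Congruences

  infix 4 _≈_mod_
  infix 3 _by_

  -- A record keeps both sides and the modulus visible to unification, which the difference x - y
  -- does not; `≈⇒≡mod` translates back at the end.
  record _≈_mod_ (x y m : ℤ) : Set where
    constructor _by_
    field
      quotient : ℤ
      equation : x - y ≡ quotient * m

  ≈-trans : ∀ {x y z m} → x ≈ y mod m → y ≈ z mod m → x ≈ z mod m
  ≈-trans {x} {y} {z} {m} (q by e) (q′ by e′) = (q + q′) by linear (e ⊞ e′) (identity x y z m q q′)
    where
    identity : ∀ x y z m q q′ → x - z - (q + q′) * m ≡ x - y + (y - z) - (q * m + q′ * m)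
    identity = solve-∀

  ≡⇒≈ : ∀ {x y m} → x ≡ y → x ≈ y mod m
  ≡⇒≈ {x} refl = 0ℤ by +-inverseʳ x

  +-≈ : ∀ {x y x′ y′ m} → x ≈ y mod m → x′ ≈ y′ mod m → x + x′ ≈ y + y′ mod m
  +-≈ {x} {y} {x′} {y′} {m} (q by e) (q′ by e′) = (q + q′) by linear (e ⊞ e′) (identity x y x′ y′ m q q′)
    where
    identity : ∀ x y x′ y′ m q q′ →
      x + x′ - (y + y′) - (q + q′) * m ≡ x - y + (x′ - y′) - (q * m + q′ * m)
    identity = solve-∀

  ∑-≈ : ∀ n {u v m} → (∀ k → u k ≈ v k mod m) → ∑ n u ≈ ∑ n v mod m
  ∑-≈ zero u≈v = ≡⇒≈ refl
  ∑-≈ (suc n) u≈v = +-≈ (∑-≈ n u≈v) (u≈v n)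

  ∑-≈0 : ∀ n {u m} → (∀ k → u k ≈ 0ℤ mod m) → ∑ n u ≈ 0ℤ mod m
  ∑-≈0 zero u≈0 = ≡⇒≈ refl
  ∑-≈0 (suc n) u≈0 = +-≈ (∑-≈0 n u≈0) (u≈0 n)

  ≈-cancel : ∀ {c w m x y} → c * w ≈ 1ℤ mod m → c * x ≈ c * y mod m → x ≈ y mod m
  ≈-cancel {c} {w} {m} {x} {y} (t by inverse) (q by e) =
    (- t * (x - y) + w * q) by linear (- (x - y) • inverse ⊞ w • e) (identity c w m x y t q)
    where
    identity : ∀ c w m x y t q → x - y - (- t * (x - y) + w * q) * m ≡
      - (x - y) * (c * w - 1ℤ) + w * (c * x - c * y) - (- (x - y) * (t * m) + w * (q * m))
    identity = solve-∀

  -- Replacing w by 1 − 2k(1 − 2kw) multiplies the error (1 + 2k)w − 1 by 4k².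
  odd-invertible : ∀ a k → ∃ λ w → (1ℤ + + 2 * k) * w ≈ 1ℤ mod + (4 ℕ.^ a)
  odd-invertible zero k = 0ℤ , (-1ℤ by identity k)
    where
    identity : ∀ k → (1ℤ + + 2 * k) * 0ℤ - 1ℤ ≡ -1ℤ * 1ℤ
    identity = solve-∀
  odd-invertible (suc a) k with w , (t by inverse) ← odd-invertible a k =
    1ℤ - + 2 * k * (1ℤ - + 2 * k * w) ,
    (k * k * t by linear (+ 4 * k * k • inverse ⊞ - (k * k * t) • pos-* 4 (4 ℕ.^ a))
      (identity k w t (+ (4 ℕ.^ a)) (+ (4 ℕ.^ suc a))))
    where
    identity : ∀ k w t m m′ →
      (1ℤ + + 2 * k) * (1ℤ - + 2 * k * (1ℤ - + 2 * k * w)) - 1ℤ - k * k * t * m′ ≡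
      + 4 * k * k * ((1ℤ + + 2 * k) * w - 1ℤ) + - (k * k * t) * m′ - (+ 4 * k * k * (t * m) + - (k * k * t) * (+ 4 * m))
    identity = solve-∀

  odd : ℕ → ℤ
  odd j = 1ℤ + + 2 * + j

  -- The alternating sum weighted by inverses of odd numbers

  module _ {Q : ℤ} (w : ℕ → ℤ) (inverse : ∀ k → odd k * w k ≈ 1ℤ mod Q) where

    W : ℕ → ℤ
    W n = ∑ (suc n) (λ k → h n k * (-1ℤ ^ k * w k))

    -- The weights cancel the factor 2k + 1 in h-suc, which leaves the alternating sum F -1ℤ.
    W-suc : ∀ n → + suc (suc n) * W (suc n) ≈ + suc n * W n + -1ℤ ^ suc n mod Q
    W-suc n = ≈-trans (≡⇒≈ (sym (∑-*ˡ (suc (suc n)) N′ (λ k → h (suc n) k * (-1ℤ ^ k * w k)))))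
      (≈-trans (∑-≈ (suc (suc n)) term) (≡⇒≈ (linear
        (∑-+ (suc (suc n)) (λ k → N * (h n k * (-1ℤ ^ k * w k))) (λ k → f (suc n) k * -1ℤ ^ k)
          ⊞ ∑-*ˡ (suc (suc n)) N (λ k → h n k * (-1ℤ ^ k * w k))
          ⊞ F-alternating (suc n)
          ⊞ N • vanish ((suc n ℕ.+ suc n) choose suc n) (-1ℤ ^ suc n * w (suc n)) (choose-beyond n))
        (identity (∑ (suc (suc n)) (λ k → N * (h n k * (-1ℤ ^ k * w k)) + f (suc n) k * -1ℤ ^ k))
          (∑ (suc (suc n)) (λ k → N * (h n k * (-1ℤ ^ k * w k)))) N (W n) (F -1ℤ (suc n)) (-1ℤ ^ suc n)
          (h n (suc n) * (-1ℤ ^ suc n * w (suc n)))))))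
      where
      N = + suc n
      N′ = + suc (suc n)
      term : ∀ k → N′ * (h (suc n) k * (-1ℤ ^ k * w k)) ≈ N * (h n k * (-1ℤ ^ k * w k)) + f (suc n) k * -1ℤ ^ k mod Q
      term k with t by e ← inverse k = f (suc n) k * -1ℤ ^ k * t by linear
        (-1ℤ ^ k * w k • h-suc n k ⊞ f (suc n) k * -1ℤ ^ k • e)
        (term-identity N′ N (h (suc n) k) (h n k) (f (suc n) k) (odd k) (w k) (-1ℤ ^ k) t Q)
        where
        term-identity : ∀ N′ N h′ h f o w ε t Q →
          N′ * (h′ * (ε * w)) - (N * (h * (ε * w)) + f * ε) - f * ε * t * Q ≡
          ε * w * (N′ * h′) + f * ε * (o * w - 1ℤ) - (ε * w * (N * h + o * f) + f * ε * (t * Q))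
        term-identity = solve-∀
      identity : ∀ s a N W F ε l → s - (N * W + ε) ≡ s + a + F + N * l - (a + F + N * (W + l) + ε + N * 0ℤ)
      identity = solve-∀

    -- By `W-suc`, (n + 1) `W n` telescopes to 1 - 1 + 1 - ... with n + 1 terms; the factor 2 avoids
    -- a division in its closed form.
    W-closed : ∀ n → + 2 * (+ suc n * W n) ≈ 1ℤ + -1ℤ ^ n mod Q
    W-closed zero = base (W 0) (trans (+-identityˡ _) (trans (*-identityˡ _) (*-identityˡ (w 0)))) (inverse 0)
      where
      base : ∀ x {y} → x ≡ y → (1ℤ + + 2 * + 0) * y ≈ 1ℤ mod Q → + 2 * (+ 1 * x) ≈ + 2 mod Q
      base x refl (t by e) = + 2 * t by linear (+ 2 • e) (identity x t Q)
        where
        identity : ∀ x t Q → + 2 * (1ℤ * x) - + 2 - + 2 * t * Q ≡ + 2 * ((1ℤ + + 2 * 0ℤ) * x - 1ℤ) - + 2 * (t * Q)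
        identity = solve-∀
    W-closed (suc n) = step (+ suc (suc n) * W (suc n)) (+ suc n * W n) (-1ℤ ^ n) (W-suc n) (W-closed n)
      where
      step : ∀ x y ε → x ≈ y + -1ℤ * ε mod Q → + 2 * y ≈ 1ℤ + ε mod Q → + 2 * x ≈ 1ℤ + -1ℤ * ε mod Q
      step x y ε (q by e) (q′ by e′) = (+ 2 * q + q′) by linear (+ 2 • e ⊞ e′) (identity x y ε q q′ Q)
        where
        identity : ∀ x y ε q q′ Q → + 2 * x - (1ℤ + -1ℤ * ε) - (+ 2 * q + q′) * Q ≡
          + 2 * (x - (y + -1ℤ * ε)) + (+ 2 * y - (1ℤ + ε)) - (+ 2 * (q * Q) + q′ * Q)
        identity = solve-∀

  -- Products over odd numbers

  O : ℕ → ℤ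
  O zero = 1ℤ
  O (suc j) = O j * (odd j * odd j)

  -- The quotient of `R M j` by `O j` is ∏ (M²/i² - 1) over the first j odd numbers i, the odd part
  -- of the product for `h` at index 2j.
  R : ℤ → ℕ → ℤ
  R M zero = 1ℤ
  R M (suc j) = R M j * (M * M - odd j * odd j)

  O≈1 : ∀ j → O j ≈ 1ℤ mod + 4
  O≈1 zero = ≡⇒≈ refl
  O≈1 (suc j) with z by e ← O≈1 j = (z * (odd j * odd j) + + j * (+ j + 1ℤ)) by linear (odd j * odd j • e)
    (identity (O j) (+ j) z)
    where
    identity : ∀ O j z →
      O * ((1ℤ + + 2 * j) * (1ℤ + + 2 * j)) - 1ℤ - (z * ((1ℤ + + 2 * j) * (1ℤ + + 2 * j)) + j * (j + 1ℤ)) * + 4 ≡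
      (1ℤ + + 2 * j) * (1ℤ + + 2 * j) * (O - 1ℤ) - (1ℤ + + 2 * j) * (1ℤ + + 2 * j) * (z * + 4)
    identity = solve-∀

  O-odd : ∀ j → ∃ λ k → O j ≡ 1ℤ + + 2 * k
  O-odd j with z by e ← O≈1 j = + 2 * z , linear e (identity (O j) z)
    where
    identity : ∀ O z → O - (1ℤ + + 2 * (+ 2 * z)) ≡ O - 1ℤ - z * + 4
    identity = solve-∀

  -- Every odd square is 1 modulo 4, so each factor M² − (2i + 1)² contributes −M² to the linear term modulo 4M².
  R≈O : ∀ N j → let M = + 2 * N in R M j ≈ -1ℤ ^ j * (O j - + j * (M * M)) mod + 4 * (M * M)
  R≈O N zero = ≡⇒≈ refl
  R≈O N (suc j) with q by e ← R≈O N j | z by e′ ← O≈1 j =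
    (q * (M * M - o) + -1ℤ ^ j * (z + + j * (+ j * (+ j + 1ℤ)) - + j * (N * N))) by linear
      ((M * M - o) • e ⊞ -1ℤ ^ j * (M * M) • e′)
      (identity (R M j) (O j) (-1ℤ ^ j) (+ j) N z q)
    where
    M = + 2 * N
    o = odd j * odd j
    identity : ∀ R O ε j N z q → let M = + 2 * N ; o = (1ℤ + + 2 * j) * (1ℤ + + 2 * j) in
      R * (M * M - o) - -1ℤ * ε * (O * o - (1ℤ + j) * (M * M))
        - (q * (M * M - o) + ε * (z + j * (j * (j + 1ℤ)) - j * (N * N))) * (+ 4 * (M * M)) ≡
      (M * M - o) * (R - ε * (O - j * (M * M))) + ε * (M * M) * (O - 1ℤ)
        - ((M * M - o) * (q * (+ 4 * (M * M))) + ε * (M * M) * (z * + 4))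
    identity = solve-∀

  double : ∀ j → + (j ℕ.* 2) ≡ + 2 * + j
  double j = trans (pos-* j 2) (*-comm (+ j) (+ 2))

  suc-double : ∀ j → + suc (j ℕ.* 2) ≡ odd j
  suc-double j = cong (λ x → 1ℤ + x) (double j)

  -- From n to 2n + 1

  odd-pair : ∀ m j → let n = suc (m ℕ.* 2) ; M = + 2 * + suc m in
    odd j * odd j * (h n (suc (j ℕ.* 2)) + h n (j ℕ.* 2)) ≡ M * M * h n (j ℕ.* 2)
  odd-pair m j = subst₂
    (λ a b → a * a * (h n (suc (j ℕ.* 2)) + h n (j ℕ.* 2)) ≡ b * b * h n (j ℕ.* 2))
    (suc-double j) (double (suc m)) (h-recurrence n (j ℕ.* 2))
    where n = suc (m ℕ.* 2)

  even-pair : ∀ m j → let n = suc (m ℕ.* 2) ; K = + 2 * + suc j ; M = + 2 * + suc m in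
    K * K * (h n (suc j ℕ.* 2) + h n (suc (j ℕ.* 2))) ≡ M * M * h n (suc (j ℕ.* 2))
  even-pair m j = subst₂
    (λ a b → a * a * (h n (suc j ℕ.* 2) + h n (suc (j ℕ.* 2))) ≡ b * b * h n (suc (j ℕ.* 2)))
    (double (suc j)) (double (suc m)) (h-recurrence n (suc (j ℕ.* 2)))
    where n = suc (m ℕ.* 2)

  -- The factors 1 - M²/i² with even i ≤ 2j form the product for `h m j`, and those with odd i
  -- contribute `R M j` over `O j`. The two signs (-1)ʲ cancel.
  h-duplication : ∀ m j → let n = suc (m ℕ.* 2) ; M = + 2 * + suc m in
    O j * h n (j ℕ.* 2) ≡ R M j * h m j
  h-duplication m zero = refl
  h-duplication m (suc j) = *-cancelˡ-≡ (K * K) (O (suc j) * h n (suc j ℕ.* 2)) (R M (suc j) * h m (suc j)) (linear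
    (O j * o • even-pair m j ⊞ (M * M - K * K) * O j • odd-pair m j
      ⊞ (M * M - K * K) * (M * M - o) • h-duplication m j
      ⊞ - (+ 4) * R M j * (M * M - o) • h-recurrence m j)
    (identity (+ suc j) (+ suc m) o (O j) (R M j)
      (h n (j ℕ.* 2)) (h n (suc (j ℕ.* 2))) (h n (suc j ℕ.* 2)) (h m j) (h m (suc j))))
    where
    n = suc (m ℕ.* 2)
    M = + 2 * + suc m
    K = + 2 * + suc j
    o = odd j * odd j
    identity : ∀ k N o O R h₀ h₁ h₂ a₀ a₁ → let M = + 2 * N ; K = + 2 * k in
      K * K * (O * o * h₂) - K * K * (R * (M * M - o) * a₁) ≡
      O * o * (K * K * (h₂ + h₁)) + (M * M - K * K) * O * (o * (h₁ + h₀))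
        + (M * M - K * K) * (M * M - o) * (O * h₀) + - (+ 4) * R * (M * M - o) * (k * k * (a₁ + a₀))
      - (O * o * (M * M * h₁) + (M * M - K * K) * O * (M * M * h₀)
        + (M * M - K * K) * (M * M - o) * (R * a₀) + - (+ 4) * R * (M * M - o) * (N * N * a₀))
    identity = solve-∀

  -- The ratio of `g` to `h` is M/(2j + 2) at index 2j + 1 for M and N/(j + 1) at index j for N, and
  -- these agree. Passing from `h` at 2j to 2j + 1 supplies the additional odd factor.
  g-duplication : ∀ m j → let n = suc (m ℕ.* 2) ; M = + 2 * + suc m in
    O (suc j) * g n (suc (j ℕ.* 2)) ≡ R M (suc j) * g m j
  g-duplication m j = *-cancelˡ-≡ (+ 2 * + suc j) (O (suc j) * g n (suc (j ℕ.* 2))) (R M (suc j) * g m j) (linear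
    (O j * o • index-change ⊞ O j * M • odd-pair m j ⊞ M * (M * M - o) • h-duplication m j
      ⊞ - (+ 2) * R M j * (M * M - o) • [k+1]g≡[n+1]h m j)
    (identity (+ suc j) (+ suc m) o (O j) (R M j) (h n (j ℕ.* 2)) (h n (suc (j ℕ.* 2))) (h m j)
      (g n (suc (j ℕ.* 2))) (g m j)))
    where
    n = suc (m ℕ.* 2)
    M = + 2 * + suc m
    o = odd j * odd j
    index-change : + 2 * + suc j * g n (suc (j ℕ.* 2)) ≡ M * h n (suc (j ℕ.* 2))
    index-change = subst₂ (λ a b → a * g n (suc (j ℕ.* 2)) ≡ b * h n (suc (j ℕ.* 2)))
      (double (suc j)) (double (suc m)) ([k+1]g≡[n+1]h n (suc (j ℕ.* 2)))
    identity : ∀ k N o O R h₀ h₁ a₀ e b → let M = + 2 * N in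
      + 2 * k * (O * o * e) - + 2 * k * (R * (M * M - o) * b) ≡
      O * o * (+ 2 * k * e) + O * M * (o * (h₁ + h₀)) + M * (M * M - o) * (O * h₀)
        + - (+ 2) * R * (M * M - o) * (k * b)
      - (O * o * (M * h₁) + O * M * (M * M * h₀) + M * (M * M - o) * (R * a₀)
        + - (+ 2) * R * (M * M - o) * (N * a₀))
    identity = solve-∀

  g-even-index : ∀ m j → let n = suc (m ℕ.* 2) ; M = + 2 * + suc m in
    odd j * g n (j ℕ.* 2) ≡ M * h n (j ℕ.* 2)
  g-even-index m j = subst₂ (λ a b → a * g n (j ℕ.* 2) ≡ b * h n (j ℕ.* 2))
    (suc-double j) (double (suc m)) ([k+1]g≡[n+1]h n (j ℕ.* 2))
    where n = suc (m ℕ.* 2)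

  sign≈1 : ∀ j → -1ℤ ^ j ≈ 1ℤ mod + 2
  sign≈1 zero = ≡⇒≈ refl
  sign≈1 (suc j) with u by e ← sign≈1 j = (-1ℤ - u) by linear (-1ℤ • e) (identity (-1ℤ ^ j) u)
    where
    identity : ∀ ε u → -1ℤ * ε - 1ℤ - (-1ℤ - u) * + 2 ≡ -1ℤ * (ε - 1ℤ) - -1ℤ * (u * + 2)
    identity = solve-∀

  sign-even : ∀ p → -1ℤ ^ (p ℕ.* 2) ≡ 1ℤ
  sign-even zero = refl
  sign-even (suc p) = trans (identity (-1ℤ ^ (p ℕ.* 2))) (sign-even p)
    where
    identity : ∀ ε → -1ℤ * (-1ℤ * ε) ≡ ε
    identity = solve-∀

  -- By `odd-pair`, an odd square times each pair of consecutive terms is a multiple of (2p + 2)²,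
  -- so each pair is even.
  S-even : ∀ p → S (suc (p ℕ.* 2)) ≈ 0ℤ mod + 2
  S-even p = ≈-trans (≡⇒≈ (∑-pairs (suc p) (h m))) (∑-≈0 (suc p) pair)
    where
    m = suc (p ℕ.* 2)
    pair : ∀ j → h m (j ℕ.* 2) + h m (suc (j ℕ.* 2)) ≈ 0ℤ mod + 2
    pair j = (P * P * + 2 * h₀ - + 2 * (+ j * + j + + j) * (h₁ + h₀)) by linear (odd-pair p j)
      (identity P (+ j) h₀ h₁)
      where
      P = + suc p
      h₀ = h m (j ℕ.* 2)
      h₁ = h m (suc (j ℕ.* 2))
      identity : ∀ P j h₀ h₁ → h₀ + h₁ - 0ℤ - (P * P * + 2 * h₀ - + 2 * (j * j + j) * (h₁ + h₀)) * + 2 ≡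
        (1ℤ + + 2 * j) * (1ℤ + + 2 * j) * (h₁ + h₀) - + 2 * P * (+ 2 * P) * h₀
      identity = solve-∀

  odd-square : ∀ j → odd j * odd j ≡ 1ℤ + + 2 * (+ 2 * (+ j * + j + + j))
  odd-square j = identity (+ j)
    where
    identity : ∀ j → (1ℤ + + 2 * j) * (1ℤ + + 2 * j) ≡ 1ℤ + + 2 * (+ 2 * (j * j + j))
    identity = solve-∀

  -- Here P = 2r, N = 4r, M = 8r, and p, m, n are P - 1, N - 1, M - 1. The numbers are variables
  -- tied by equations, so that powers of two can be supplied without being unfolded in the
  -- argument.
  module Duplication
    (p : ℕ) {m n : ℕ} {r P N M : ℤ} (m≡ : suc (p ℕ.* 2) ≡ m) (n≡ : suc (m ℕ.* 2) ≡ n)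
    (P≡ : + suc p ≡ P) (N≡ : + suc m ≡ N) (M≡ : + 2 * N ≡ M) (P≡2r : P ≡ + 2 * r)
    (invertible : ∀ k → ∃ λ w → (1ℤ + + 2 * k) * w ≈ 1ℤ mod + 4 * (M * M))
    where

    N≡2P : N ≡ + 2 * P
    N≡2P = trans (sym N≡) (trans (cong (λ x → + suc x) (sym m≡)) (trans (double (suc p)) (cong (λ x → + 2 * x) P≡)))

    n+1≡M : + suc n ≡ M
    n+1≡M = trans (cong (λ x → + suc x) (sym n≡)) (trans (double (suc m)) (trans (cong (λ x → + 2 * x) N≡) M≡))

    at-M : (φ : ℕ → ℤ → Set) → φ (suc (m ℕ.* 2)) (+ 2 * + suc m) → φ n M
    at-M φ = subst₂ φ n≡ (trans (cong (λ x → + 2 * x) N≡) M≡)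

    h-dup-exact : ∀ j → O j * h n (j ℕ.* 2) ≡ R M j * h m j
    h-dup-exact j = at-M (λ n M → O j * h n (j ℕ.* 2) ≡ R M j * h m j) (h-duplication m j)

    g-dup-exact : ∀ j → O (suc j) * g n (suc (j ℕ.* 2)) ≡ R M (suc j) * g m j
    g-dup-exact j = at-M (λ n M → O (suc j) * g n (suc (j ℕ.* 2)) ≡ R M (suc j) * g m j) (g-duplication m j)

    h-pair : ∀ j → odd j * odd j * (h n (suc (j ℕ.* 2)) + h n (j ℕ.* 2)) ≡ M * M * h n (j ℕ.* 2)
    h-pair j = at-M (λ n M → odd j * odd j * (h n (suc (j ℕ.* 2)) + h n (j ℕ.* 2)) ≡ M * M * h n (j ℕ.* 2))
      (odd-pair m j)

    g-from-h : ∀ j → odd j * g n (j ℕ.* 2) ≡ M * h n (j ℕ.* 2)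
    g-from-h j = at-M (λ n M → odd j * g n (j ℕ.* 2) ≡ M * h n (j ℕ.* 2)) (g-even-index m j)

    gm-from-hm : ∀ j → + suc j * g m j ≡ N * h m j
    gm-from-hm j = subst (λ N → + suc j * g m j ≡ N * h m j) N≡ ([k+1]g≡[n+1]h m j)

    R≈O-at-M : ∀ j → R M j ≈ -1ℤ ^ j * (O j - + j * (M * M)) mod + 4 * (M * M)
    R≈O-at-M j = subst (λ M → R M j ≈ -1ℤ ^ j * (O j - + j * (M * M)) mod + 4 * (M * M)) M≡ (R≈O N j)

    invertible-weak : ∀ k → ∃ λ w → (1ℤ + + 2 * k) * w ≈ 1ℤ mod M * M
    invertible-weak k with w , (t by e) ← invertible k =
      w , (t * + 4 by trans e (sym (*-assoc t (+ 4) (M * M))))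

    cancel-O : ∀ {Q} → (∀ k → ∃ λ w → (1ℤ + + 2 * k) * w ≈ 1ℤ mod Q) →
      ∀ j {x y} → O j * x ≈ O j * y mod Q → x ≈ y mod Q
    cancel-O {Q} inv j {x} {y} Ox≈Oy with k , O≡odd ← O-odd j =
      ≈-cancel {1ℤ + + 2 * k} {proj₁ (inv k)} (proj₂ (inv k)) (subst (λ c → c * x ≈ c * y mod Q) O≡odd Ox≈Oy)

    -- Modulo M² the linear term of `R≈O` disappears. This precision suffices because later uses
    -- multiply by M or by 2M².
    h-dup : ∀ j → h n (j ℕ.* 2) ≈ -1ℤ ^ j * h m j mod M * M
    h-dup j with q by e ← R≈O-at-M j = cancel-O invertible-weak j
      ((+ 4 * q * h m j - -1ℤ ^ j * + j * h m j) by linear (h-dup-exact j ⊞ h m j • e)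
        (identity (O j) (R M j) (h n (j ℕ.* 2)) (h m j) (-1ℤ ^ j) (+ j) q (M * M)))
      where
      identity : ∀ O R h a ε j q X → O * h - O * (ε * a) - (+ 4 * q * a - ε * j * a) * X ≡
        O * h + a * (R - ε * (O - j * X)) - (R * a + a * (q * (+ 4 * X)))
      identity = solve-∀

    -- The linear term of `R≈O` contributes (j + 1) M² `g m j` up to sign. As (j + 1) `g m j` = N
    -- `h m j` and N = 4r, it vanishes modulo 4M².
    g-odd : ∀ j → g n (suc (j ℕ.* 2)) ≈ -1ℤ * (g m j * -1ℤ ^ j) mod + 4 * (M * M)
    g-odd j = cancel-O invertible (suc j) (combine (O (suc j)) (g n (suc (j ℕ.* 2))) (g m j) (h m j) (+ suc j) refl
      (R≈O-at-M (suc j)) (g-dup-exact j) (gm-from-hm j))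
      where
      combine : ∀ O {R} e b a {ε ε′} k → ε′ ≡ -1ℤ * ε → R ≈ ε′ * (O - k * (M * M)) mod + 4 * (M * M) →
        O * e ≡ R * b → k * b ≡ N * a → O * e ≈ O * (-1ℤ * (b * ε)) mod + 4 * (M * M)
      combine O {R} e b a {ε} k refl (q by e₁) e₂ e₃ = (q * b + ε * (r * a)) by linear
        (e₂ ⊞ b • e₁ ⊞ ε * (M * M) • (e₃ ⊞ a • N≡2P ⊞ + 2 * a • P≡2r))
        (identity O R e b a ε k q (M * M) N P r)
        where
        identity : ∀ O R e b a ε k q X N P r →
          O * e - O * (-1ℤ * (b * ε)) - (q * b + ε * (r * a)) * (+ 4 * X) ≡
          O * e + b * (R - -1ℤ * ε * (O - k * X)) + ε * X * (k * b + a * N + + 2 * a * P)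
          - (R * b + b * (q * (+ 4 * X)) + ε * X * (N * a + a * (+ 2 * P) + + 2 * a * (+ 2 * r)))
        identity = solve-∀

    w : ℕ → ℤ
    w j = proj₁ (invertible (+ j))

    w-inverse : ∀ j → odd j * w j ≈ 1ℤ mod + 4 * (M * M)
    w-inverse j = proj₂ (invertible (+ j))

    -- Since `g n (j ℕ.* 2)` is M/(2j + 1) times the `h` term, the congruence of `h-dup` rises to
    -- modulus M³, a multiple of 4M² because M = 4P.
    g-even : ∀ j → g n (j ℕ.* 2) ≈ M * (h m j * (-1ℤ ^ j * w j)) mod + 4 * (M * M)
    g-even j = combine (g n (j ℕ.* 2)) (odd j) (w j) (h m j) (h n (j ℕ.* 2)) (-1ℤ ^ j)
      (w-inverse j) (h-dup j) (g-from-h j)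
      where
      combine : ∀ d o w a h ε → o * w ≈ 1ℤ mod + 4 * (M * M) → h ≈ ε * a mod M * M → o * d ≡ M * h →
        d ≈ M * (a * (ε * w)) mod + 4 * (M * M)
      combine d o w a h ε (t by e) (s by e′) e″ = (- t * d + w * P * s) by linear
        (- d • e ⊞ w • e″ ⊞ w * M • e′ ⊞ + 2 * w * s * (M * M) • N≡2P ⊞ - (w * s * (M * M)) • M≡)
        (identity d o w N M P a h ε t s)
        where
        identity : ∀ d o w N M P a h ε t s → let X = M * M in
          d - M * (a * (ε * w)) - (- t * d + w * P * s) * (+ 4 * X) ≡
          - d * (o * w - 1ℤ) + w * (o * d) + w * M * (h - ε * a) + + 2 * w * s * X * N + - (w * s * X) * (+ 2 * N)
          - (- d * (t * (+ 4 * X)) + w * (M * h) + w * M * (s * X) + + 2 * w * s * X * (+ 2 * P) + - (w * s * X) * M)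
        identity = solve-∀

    Wm : ℤ
    Wm = W w w-inverse m

    N*W : + 2 * (N * Wm) ≈ 1ℤ + -1ℤ ^ m mod + 4 * (M * M)
    N*W = subst (λ N → + 2 * (N * Wm) ≈ 1ℤ + -1ℤ ^ m mod + 4 * (M * M)) N≡ (W-closed w w-inverse m)

    T-split : ∑ (suc n) (g n) ≡ ∑ (suc m) (λ j → g n (j ℕ.* 2) + g n (suc (j ℕ.* 2)))
    T-split = trans (cong (λ l → ∑ (suc l) (g n)) (sym n≡)) (∑-pairs (suc m) (g n))

    S-split : S n ≡ ∑ (suc m) (λ j → h n (j ℕ.* 2) + h n (suc (j ℕ.* 2)))
    S-split = trans (cong (λ l → ∑ (suc l) (h n)) (sym n≡)) (∑-pairs (suc m) (h n))

    -- The sums T and S and the Delannoy numbers modulo 4M²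

    T≈1 : G 1ℤ n ≈ 1ℤ mod + 4 * (M * M)
    T≈1 = ≈-trans (≡⇒≈ (trans (∑-cong (suc n) (λ k → *-1^ (g n k) k)) T-split))
      (≈-trans (∑-≈ (suc m) (λ j → +-≈ (g-even j) (g-odd j)))
      (≈-trans (≡⇒≈ (trans (∑-+ (suc m) (λ j → M * (h m j * (-1ℤ ^ j * w j))) (λ j → -1ℤ * (g m j * -1ℤ ^ j)))
        (cong₂ _+_ (∑-*ˡ (suc m) M (λ j → h m j * (-1ℤ ^ j * w j))) (∑-*ˡ (suc m) -1ℤ (λ j → g m j * -1ℤ ^ j)))))
      -- With ε = (-1)ᵐ, the even indices give M `Wm` = 2N `Wm` ≡ 1 + ε and the odd ones give -ε,
      -- leaving 1.
      (combine Wm (G -1ℤ m) (-1ℤ ^ m) (G-alternating m) N*W)))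
      where
      combine : ∀ W G ε → G ≡ ε → + 2 * (N * W) ≈ 1ℤ + ε mod + 4 * (M * M) →
        M * W + -1ℤ * G ≈ 1ℤ mod + 4 * (M * M)
      combine W G ε refl (q by e) = q by linear (e ⊞ - W • M≡) (identity W G N M q)
        where
        identity : ∀ W G N M q → let Q = + 4 * (M * M) in M * W + -1ℤ * G - 1ℤ - q * Q ≡
          + 2 * (N * W) - (1ℤ + G) + - W * (+ 2 * N) - (q * Q + - W * M)
        identity = solve-∀

    -- In twice `h-pair`, replacing the odd square 1 + 2k by 1 costs 4k times the pair, a multiple
    -- of 4M² because the pair is divisible by M². On the right, 2M² leaves the `h` term to be known
    -- only modulo 2, where the sign is irrelevant.
    pair≈ : ∀ j → + 2 * (h n (j ℕ.* 2) + h n (suc (j ℕ.* 2))) ≈ + 2 * (M * M) * h m j mod + 4 * (M * M)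
    pair≈ j = combine (h n (j ℕ.* 2)) (h n (suc (j ℕ.* 2))) (h m j) (-1ℤ ^ j) (+ 2 * (+ j * + j + + j)) (odd j * odd j)
      (odd-square j) (h-pair j) (h-dup j) (sign≈1 j)
      where
      divisible : ∀ k x h → (1ℤ + + 2 * k) * x ≡ M * M * h → x ≈ 0ℤ mod M * M
      divisible k x h e = ≈-cancel {1ℤ + + 2 * k} {proj₁ (invertible-weak k)} (proj₂ (invertible-weak k))
        (h by linear e (identity k x h (M * M)))
        where
        identity : ∀ k x h X →
          (1ℤ + + 2 * k) * x - (1ℤ + + 2 * k) * 0ℤ - h * X ≡ (1ℤ + + 2 * k) * x - X * h
        identity = solve-∀
      combine : ∀ h₀ h₁ a ε k o → o ≡ 1ℤ + + 2 * k → o * (h₁ + h₀) ≡ M * M * h₀ → h₀ ≈ ε * a mod M * M → ε ≈ 1ℤ mod + 2 →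
        + 2 * (h₀ + h₁) ≈ + 2 * (M * M) * a mod + 4 * (M * M)
      combine h₀ h₁ a ε k o refl pair (s by e) (u by e′) with c by e″ ← divisible k (h₁ + h₀) h₀ pair =
        (N * N * + 2 * s + u * a - k * c) by linear
          (+ 2 • pair ⊞ - (+ 4) * k • e″ ⊞ + 2 * (M * M) • e ⊞ + 2 * (M * M) * a • e′
            ⊞ - (+ 2 * s * (M * M) * (+ 2 * N + M)) • M≡)
          (identity N M k h₀ h₁ a ε c s u)
        where
        identity : ∀ N M k h₀ h₁ a ε c s u → let X = M * M in
          + 2 * (h₀ + h₁) - + 2 * X * a - (N * N * + 2 * s + u * a - k * c) * (+ 4 * X) ≡
          + 2 * ((1ℤ + + 2 * k) * (h₁ + h₀)) + - (+ 4) * k * (h₁ + h₀ - 0ℤ) + + 2 * X * (h₀ - ε * a)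
            + + 2 * X * a * (ε - 1ℤ) + - (+ 2 * s * X * (+ 2 * N + M)) * (+ 2 * N)
          - (+ 2 * (X * h₀) + - (+ 4) * k * (c * X) + + 2 * X * (s * X) + + 2 * X * a * (u * + 2)
            + - (+ 2 * s * X * (+ 2 * N + M)) * M)
        identity = solve-∀

    S-m-even : S m ≈ 0ℤ mod + 2
    S-m-even = subst (λ m → S m ≈ 0ℤ mod + 2) m≡ (S-even p)

    2S≈0 : + 2 * S n ≈ 0ℤ mod + 4 * (M * M)
    2S≈0 = ≈-trans (≡⇒≈ (trans (cong (λ x → + 2 * x) S-split)
        (sym (∑-*ˡ (suc m) (+ 2) (λ j → h n (j ℕ.* 2) + h n (suc (j ℕ.* 2)))))))
      (≈-trans (∑-≈ (suc m) pair≈)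
      (≈-trans (≡⇒≈ (∑-*ˡ (suc m) (+ 2 * (M * M)) (h m)))
      (combine (S m) S-m-even)))
      where
      combine : ∀ S → S ≈ 0ℤ mod + 2 → + 2 * (M * M) * S ≈ 0ℤ mod + 4 * (M * M)
      combine S (z by e) = z by linear (+ 2 * (M * M) • e) (identity (M * M) S z)
        where
        identity : ∀ X S z → + 2 * X * S - 0ℤ - z * (+ 4 * X) ≡ + 2 * X * (S - 0ℤ) - + 2 * X * (z * + 2)
        identity = solve-∀

    D-pred : F 1ℤ n ≈ -1ℤ mod + 4 * (M * M)
    D-pred = combine (F 1ℤ n) (S n) (G 1ℤ n) (F≡2S-G n) 2S≈0 T≈1
      where
      combine : ∀ F S T → F ≡ + 2 * S - T → + 2 * S ≈ 0ℤ mod + 4 * (M * M) → T ≈ 1ℤ mod + 4 * (M * M) →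
        F ≈ -1ℤ mod + 4 * (M * M)
      combine F S T F≡ (q by e) (q′ by e′) = (q - q′) by linear (F≡ ⊞ e ⊞ -1ℤ • e′)
        (identity F S T q q′ (+ 4 * (M * M)))
        where
        identity : ∀ F S T q q′ Q → F - -1ℤ - (q - q′) * Q ≡
          F + (+ 2 * S - 0ℤ) + -1ℤ * (T - 1ℤ) - (+ 2 * S - T + q * Q + -1ℤ * (q′ * Q))
        identity = solve-∀

    D-mid : F 1ℤ (suc n) ≈ 1ℤ mod + 4 * (M * M)
    D-mid = combine (F 1ℤ (suc n)) (F 1ℤ n) (G 1ℤ n) (F-suc 1ℤ n) D-pred T≈1
      where
      combine : ∀ F′ F T → F′ ≡ F + + 2 * 1ℤ * T → F ≈ -1ℤ mod + 4 * (M * M) → T ≈ 1ℤ mod + 4 * (M * M) →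
        F′ ≈ 1ℤ mod + 4 * (M * M)
      combine F′ F T F′≡ (q by e) (q′ by e′) = (q + + 2 * q′) by linear (F′≡ ⊞ e ⊞ + 2 • e′)
        (identity F′ F T q q′ (+ 4 * (M * M)))
        where
        identity : ∀ F′ F T q q′ Q → F′ - 1ℤ - (q + + 2 * q′) * Q ≡
          F′ + (F - -1ℤ) + + 2 * (T - 1ℤ) - (F + + 2 * 1ℤ * T + q * Q + + 2 * (q′ * Q))
        identity = solve-∀

    G-recurrence : (1ℤ + M) * G 1ℤ (suc n) ≡ M * G 1ℤ n + (1ℤ + + 2 * M) * F 1ℤ (suc n)
    G-recurrence = trans (cong (_* G 1ℤ (suc n)) (cong (λ x → 1ℤ + x) (sym n+1≡M)))
      (trans (G-suc 1ℤ n) (cong₂ _+_ (cong (_* G 1ℤ n) n+1≡M) (cong (_* F 1ℤ (suc n))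
        (trans (shift (+ n)) (cong (λ x → 1ℤ + + 2 * x) n+1≡M)))))
      where
      shift : ∀ n → + 3 + + 2 * n ≡ 1ℤ + + 2 * (1ℤ + n)
      shift = solve-∀

    -- With D_M ≡ T ≡ 1 the recurrence gives (1 + M) D_{M+1} ≡ (1 + M) + 2(1 + 3M) = 3 + 7M, which
    -- is (1 + M)(3 + 4M) - 4M². The factor 1 + M = 1 + 2N is odd and cancels.
    D-suc : F 1ℤ (suc (suc n)) ≈ + 3 + + 4 * M mod + 4 * (M * M)
    D-suc = combine (F 1ℤ (suc (suc n))) (F 1ℤ (suc n)) (G 1ℤ (suc n)) (G 1ℤ n) (F-suc 1ℤ (suc n)) G-recurrence
      D-mid T≈1
      where
      combine : ∀ F″ F T′ T → F″ ≡ F + + 2 * 1ℤ * T′ → (1ℤ + M) * T′ ≡ M * T + (1ℤ + + 2 * M) * F →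
        F ≈ 1ℤ mod + 4 * (M * M) → T ≈ 1ℤ mod + 4 * (M * M) → F″ ≈ + 3 + + 4 * M mod + 4 * (M * M)
      combine F″ F T′ T F″≡ T′≡ (q by e) (q′ by e′) = ≈-cancel {1ℤ + M} {proj₁ (invertible N)}
        (subst (λ M′ → (1ℤ + M′) * proj₁ (invertible N) ≈ 1ℤ mod + 4 * (M * M)) M≡ (proj₂ (invertible N)))
        (((+ 5 * M + + 3) * q + + 2 * M * q′ - 1ℤ) by linear
          ((1ℤ + M) • F″≡ ⊞ + 2 • T′≡ ⊞ (+ 5 * M + + 3) • e ⊞ + 2 * M • e′)
          (identity F″ F T′ T M q q′))
        where
        identity : ∀ F″ F T′ T M q q′ → let Q = + 4 * (M * M) in
          (1ℤ + M) * F″ - (1ℤ + M) * (+ 3 + + 4 * M) - ((+ 5 * M + + 3) * q + + 2 * M * q′ - 1ℤ) * Q ≡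
          (1ℤ + M) * F″ + + 2 * ((1ℤ + M) * T′) + (+ 5 * M + + 3) * (F - 1ℤ) + + 2 * M * (T - 1ℤ)
          - ((1ℤ + M) * (F + + 2 * 1ℤ * T′) + + 2 * (M * T + (1ℤ + + 2 * M) * F)
            + (+ 5 * M + + 3) * (q * Q) + + 2 * M * (q′ * Q))
        identity = solve-∀

  -- Powers of two

  4^[a+1]≡4*2^a*2^a : ∀ a → + (4 ℕ.^ (a ℕ.+ 1)) ≡ + 4 * (+ (2 ℕ.^ a) * + (2 ℕ.^ a))
  4^[a+1]≡4*2^a*2^a a = begin
    + (4 ℕ.^ (a ℕ.+ 1))                    ≡⟨ cong (λ l → + (4 ℕ.^ l)) (ℕ.+-comm a 1) ⟩
    + (4 ℕ.* 4 ℕ.^ a)                      ≡⟨ cong (λ x → + (4 ℕ.* x)) 4^a≡2^a*2^a ⟩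
    + (4 ℕ.* (2 ℕ.^ a ℕ.* 2 ℕ.^ a))        ≡⟨ pos-* 4 (2 ℕ.^ a ℕ.* 2 ℕ.^ a) ⟩
    + 4 * + (2 ℕ.^ a ℕ.* 2 ℕ.^ a)          ≡⟨ cong (λ x → + 4 * x) (pos-* (2 ℕ.^ a) (2 ℕ.^ a)) ⟩
    + 4 * (+ (2 ℕ.^ a) * + (2 ℕ.^ a))      ∎
    where
    open ≡-Reasoning
    4^a≡2^a*2^a : 4 ℕ.^ a ≡ 2 ℕ.^ a ℕ.* 2 ℕ.^ a
    4^a≡2^a*2^a = trans (ℕ.^-*-assoc 2 2 a)
      (trans (ℕ.^-distribˡ-+-* 2 a (a ℕ.+ 0)) (cong (λ l → 2 ℕ.^ a ℕ.* 2 ℕ.^ l) (ℕ.+-identityʳ a)))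

  module _ (b : ℕ) where

    private
      a p m n : ℕ
      a = suc (suc (suc b))
      p = ℕ.pred (2 ℕ.^ suc b)
      m = suc (p ℕ.* 2)
      n = suc (m ℕ.* 2)

      M : ℤ
      M = + (2 ℕ.^ a)

      P≡ : + suc p ≡ + (2 ℕ.^ suc b)
      P≡ = cong +_ (ℕ.suc-pred (2 ℕ.^ suc b) {{ℕ.m^n≢0 2 (suc b)}})

      N≡ : + suc m ≡ + (2 ℕ.^ suc (suc b))
      N≡ = trans (double (suc p)) (trans (cong (λ x → + 2 * x) P≡) (sym (pos-* 2 (2 ℕ.^ suc b))))

      invertible : ∀ k → ∃ λ w → (1ℤ + + 2 * k) * w ≈ 1ℤ mod + 4 * (M * M)
      invertible = subst (λ Q → ∀ k → ∃ λ w → (1ℤ + + 2 * k) * w ≈ 1ℤ mod Q) (4^[a+1]≡4*2^a*2^a a)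
        (odd-invertible (a ℕ.+ 1))

      -- The exponent a = b + 3 leaves r = 2ᵇ after the factor 8 is taken out of M.
      module D = Duplication p {r = + (2 ℕ.^ b)} refl refl P≡ N≡
        (sym (pos-* 2 (2 ℕ.^ suc (suc b)))) (pos-* 2 (2 ℕ.^ b)) invertible

      n+1≡2^a : suc n ≡ 2 ℕ.^ a
      n+1≡2^a = +-injective D.n+1≡M

    D[2^a+1] : + D (2 ℕ.^ a ℕ.+ 1) ≈ + (3 ℕ.+ 2 ℕ.^ (a ℕ.+ 2)) mod + (4 ℕ.^ (a ℕ.+ 1))
    D[2^a+1] = subst₂ (λ l Q → + D l ≈ + (3 ℕ.+ 2 ℕ.^ (a ℕ.+ 2)) mod Q)
      (trans (cong suc n+1≡2^a) (ℕ.+-comm 1 (2 ℕ.^ a))) (sym (4^[a+1]≡4*2^a*2^a a))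
      (≈-trans (≡⇒≈ (D≡F (suc (suc n)))) (≈-trans D.D-suc (≡⇒≈ (cong (λ x → + 3 + x) 4M≡2^[a+2]))))
      where
      4M≡2^[a+2] : + 4 * M ≡ + (2 ℕ.^ (a ℕ.+ 2))
      4M≡2^[a+2] = trans (sym (pos-* 4 (2 ℕ.^ a)))
        (cong +_ (trans (ℕ.*-comm 4 (2 ℕ.^ a)) (sym (ℕ.^-distribˡ-+-* 2 a 2))))

    D[2^a-1] : + D (2 ℕ.^ a ℕ.∸ 1) ≈ -1ℤ mod + (4 ℕ.^ (a ℕ.+ 1))
    D[2^a-1] = subst₂ (λ l Q → + D l ≈ -1ℤ mod Q)
      (cong (ℕ._∸ 1) n+1≡2^a) (sym (4^[a+1]≡4*2^a*2^a a)) (≈-trans (≡⇒≈ (D≡F n)) D.D-pred)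

  ≈⇒≡mod : ∀ {x y m} → x ≈ y mod m → x ≡ y [mod m ]
  ≈⇒≡mod (q by e) = divides q e

open import Data.Nat.Base using (_+_; _∸_; _^_; _≤_)
open import Data.Product.Base using (_×_)
open DelannoyCongruences using (D[2^a+1]; D[2^a-1]; ≈⇒≡mod)

theorem3p1 : (a : ℕ) → 2 ≤ a →
    (+ D (2 ^ a + 1) ≡ + (3 + 2 ^ (a + 2)) [mod + (4 ^ (a + 1)) ])
    × (+ D (2 ^ a ∸ 1) ≡ -1ℤ [mod + (4 ^ (a + 1)) ])
theorem3p1 (suc zero) (s≤s ())
-- Modulo 64: D_5 = 1683 = 19 + 26 · 64 and D_3 = 63 = -1 + 64.
theorem3p1 (suc (suc zero)) _ = divides (+ 26) refl , divides (+ 1) refl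
theorem3p1 (suc (suc (suc b))) _ = ≈⇒≡mod (D[2^a+1] b) , ≈⇒≡mod (D[2^a-1] b)
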